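{- Let $F$ be a recurrent set and let $X\subset F$ be a bifix code. Then $X$ is an $F$-thin and $F$-maximal bifix code if and only if its $F$-degree $d_F(X)$ is finite. In this case the set $I(X)$ of internal factors of $X$ satisfies $I(X)=\{w\in F\mid \delta_X(w)<d_F(X)\}$.
   Context: $A$ is a finite alphabet. A set $F\subset A^*$ is recurrent if it is nonempty, contains all factors of its elements, and for all $u,w\in F$ there is $v\in F$ with $uvw\in F$. A bifix code is a set $X\subset A^+$ such that no element is a proper prefix or a proper suffix of another element. For $X\subset F$, $X$ is an $F$-maximal bifix code if it is not properly contained in any bifix code $Y\subset F$, and $F$-thin if some word of $F$ is not a factor of a word of $X$. A parse of a word $w$ with respect to $X$ is a triple $(v,x,u)$ with $w=vxu$, $v\in A^*\setminus A^*X$ (no suffix of $v$ lies in $X$), $x\in X^*$, $u\in A^*\setminus XA^*$ (no prefix of $u$ lies in $X$); $\delta_X(w)$ is the number of parses of $w$. The $F$-degree is $d_F(X)=\max_{w\in F}\delta_X(w)$ (possibly infinite). $I(X)=\{w\in A^*\mid A^+wA^+\cap X\ne\emptyset\}$. -}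

module Defs where

open import Level using (0ℓ)
open import Data.List using (List; []; _++_; concat; length)
open import Data.List.Membership.Propositional using () renaming (_∈_ to _∈ₗ_)
open import Data.List.Relation.Binary.Infix.Heterogeneous using (Infix)
open import Data.List.Relation.Binary.Prefix.Heterogeneous using (Prefix)
open import Data.List.Relation.Binary.Suffix.Heterogeneous using (Suffix)
open import Data.List.Relation.Unary.All using (All)
open import Data.List.Relation.Unary.Unique.Propositional using (Unique)
open import Data.Nat using (ℕ; _≤_; _<_)
open import Data.Product using (_×_; _,_; ∃-syntax)
open import Function.Bundles using (_⇔_)
open import Relation.Binary.PropositionalEquality using (_≡_; _≢_)
open import Relation.Nullary using (¬_)
open import Relation.Unary using (Pred; _∈_; _∉_; _⊆_; _⊄_)

Word : Set → Set
Word A = List A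

Language : Set → Set₁
Language A = Pred (Word A) 0ℓ

module _ {A : Set} where

  IsPrefix IsSuffix IsFactor : Word A → Word A → Set
  IsPrefix = Prefix _≡_
  IsSuffix = Suffix _≡_
  IsFactor = Infix _≡_

  record IsRecurrent (F : Language A) : Set where
    field
      nonempty  : ∃[ w ] w ∈ F
      factorial : ∀ {u w} → IsFactor u w → w ∈ F → u ∈ F
      recurrent : ∀ {u w} → u ∈ F → w ∈ F → ∃[ v ] (v ∈ F × u ++ v ++ w ∈ F)

  record IsBifixCode (X : Language A) : Set where
    field
      nonempty-words   : ∀ {x} → x ∈ X → x ≢ []
      no-proper-prefix : ∀ {x y} → x ∈ X → y ∈ X → ¬ (IsPrefix x y × x ≢ y)
      no-proper-suffix : ∀ {x y} → x ∈ X → y ∈ X → ¬ (IsSuffix x y × x ≢ y)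

  record IsMaximalBifixCode (F X : Language A) : Set₁ where
    field
      included : X ⊆ F
      bifix    : IsBifixCode X
      maximal  : ∀ (Y : Language A) → IsBifixCode Y → Y ⊆ F → X ⊄ Y

  IsThin : Language A → Language A → Set
  IsThin F X = ∃[ w ] (w ∈ F × ¬ (∃[ x ] (x ∈ X × IsFactor w x)))

  _* : Language A → Language A
  (X *) w = ∃[ xs ] (All X xs × concat xs ≡ w)

  A*∙_ : Language A → Language A
  (A*∙ X) w = ∃[ x ] (x ∈ X × IsSuffix x w)

  _∙A* : Language A → Language A
  (X ∙A*) w = ∃[ x ] (x ∈ X × IsPrefix x w)

  IsParse : Language A → Word A → Word A × Word A × Word A → Set
  IsParse X w (v , x , u) = (w ≡ v ++ x ++ u) × v ∉ (A*∙ X) × x ∈ (X *) × u ∉ (X ∙A*)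

  -- δ_X(w) = n.  The parses are counted as triples of words (listed without
  -- repetition), not as inhabitants of IsParse, which is not proof-irrelevant.
  ParseCount : Language A → Word A → ℕ → Set
  ParseCount X w n = ∃[ ps ] (Unique ps × (∀ t → t ∈ₗ ps ⇔ IsParse X w t) × length ps ≡ n)

  -- d_F(X) = d for a natural number d: the maximum of δ_X over F exists and is d.
  IsDegree : Language A → Language A → ℕ → Set
  IsDegree F X d = (∃[ w ] (w ∈ F × ParseCount X w d))
                 × (∀ w → w ∈ F → ∃[ n ] (ParseCount X w n × n ≤ d))

  HasFiniteDegree : Language A → Language A → Set
  HasFiniteDegree F X = ∃[ d ] IsDegree F X d

  InternalFactors : Language A → Language A
  InternalFactors X w = ∃[ p ] ∃[ s ] (p ≢ [] × s ≢ [] × p ++ w ++ s ∈ X)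

  -- { w ∈ F ∣ δ_X(w) < d }
  ParseCountBelow : Language A → Language A → ℕ → Language A
  ParseCountBelow F X d w = w ∈ F × (∃[ n ] (ParseCount X w n × n < d))

{-# OPTIONS --safe #-}
module Submission where

-- A parse (v , x , u) of w is determined by v, which can be any prefix of w outside A*X,
-- and dually by u, which can be any suffix of w outside XA*.  Hence
--   δ(wa) = δ(w) + [wa ∉ A*X]   and   δ(aw) = δ(w) + [aw ∉ XA*].
-- If δ is maximal at z ∈ F, every t z ∈ F with t ≢ ε lies in XA*.  This makes X maximal
-- (apply it to y v z for y in a larger bifix code) and, applied inside some z p w s z ∈ F,
-- exhibits w as an internal factor when δ(w) < δ(z).
-- Conversely, if X is maximal then all nonempty words of F are prefix-comparable with X, or all
-- are suffix-comparable; in the first case a word z ∈ F that is not a factor of X satisfies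
-- δ(t z) = δ(z) for all t z ∈ F, so δ(z) bounds δ by recurrence, and the second case is dual.

open import Defs
open import Axiom.ExcludedMiddle using (ExcludedMiddle)
open import Data.Fin using (Fin)
open import Data.List using ([]; _∷_; _∷ʳ_; [_]; _++_; concat; filter; initLast; _∷ʳ′_; inits; length; map; reverse)
open import Data.List.Membership.Propositional using () renaming (_∈_ to _∈ₗ_)
open import Data.List.Membership.Propositional.Properties using (∈-filter⁺; ∈-filter⁻; ∈-map⁺; ∈-map⁻; []∉map∷)
open import Data.List.Membership.Propositional.Properties.WithK using (unique∧set⇒bag)
open import Data.List.Properties
open import Data.List.Relation.Binary.BagAndSetEquality using (∼bag⇒↭)
open import Data.List.Relation.Binary.Infix.Heterogeneous.Properties using (fromSuffix)
open import Data.List.Relation.Binary.Permutation.Propositional.Properties using (↭-length)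
open import Data.List.Relation.Binary.Suffix.Heterogeneous.Properties using (fromPrefix; fromPrefix-rev; toPrefix-rev)
open import Data.List.Relation.Unary.All using (All; []; _∷_)
open import Data.List.Relation.Unary.AllPairs using ([]; _∷_)
open import Data.List.Relation.Unary.Any using (here; there)
open import Data.List.Relation.Unary.Unique.Propositional using (Unique)
open import Data.Nat using (ℕ; suc; _+_; _≤_; _<_; s≤s)
open import Data.Nat.Induction using (<-wellFounded)
open import Data.Nat.Properties
open import Data.Product using (_×_; _,_; ∃-syntax; proj₁)
open import Data.Sum using (_⊎_; inj₁; inj₂)
open import Function.Base using (_∘_)
open import Function.Bundles using (_⇔_; _↔_; mk⇔; Equivalence)
open import Induction.WellFounded using (Acc; acc)
open import Level using (0ℓ)
open import Relation.Binary.PropositionalEquality using (_≡_; _≢_; refl; sym; trans; cong; cong₂; subst; subst₂)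
open import Relation.Nullary using (¬_; Dec; yes; no; contradiction)
open import Relation.Nullary.Decidable using (decidable-stable)
open import Relation.Unary using (_∈_; _∉_; _⊆_; _≐_)
import Data.List.Relation.Binary.Infix.Heterogeneous as Infix
import Data.List.Relation.Binary.Pointwise as Pointwise
import Data.List.Relation.Binary.Prefix.Heterogeneous as Prefix
import Data.List.Relation.Binary.Suffix.Heterogeneous as Suffix
import Data.List.Relation.Unary.All as All
import Data.List.Relation.Unary.All.Properties as Allₚ
import Data.List.Relation.Unary.Unique.Propositional.Properties as Uniqueₚ

open Infix using (_++ⁱ_; _ⁱ++_; here)
open Prefix using ([]; _∷_)

-- Enumeration through an injective map.

preimages : ∀ {B C : Set} (f : B → C) {P : B → Set} {cs} →
            All (λ c → ∃[ b ] (P b × f b ≡ c)) cs →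
            ∃[ bs ] (All P bs × map f bs ≡ cs)
preimages f []                    = [] , [] , refl
preimages f ((b , pb , refl) ∷ h) =
  let bs , pbs , eq = preimages f h in b ∷ bs , pb ∷ pbs , cong (f b ∷_) eq

-- The chosen preimages `bs` map onto `cs`, so they inherit distinctness from it; injectivity on `P`
-- makes every `b` satisfying `P` the preimage chosen for `f b`. This serves to list parses from the
-- list of their first components.
enumerate-via : ∀ {B C : Set} (f : B → C) {P : B → Set} {cs} → Unique cs →
                (∀ {c} → c ∈ₗ cs → ∃[ b ] (P b × f b ≡ c)) →
                (∀ {b} → P b → f b ∈ₗ cs) →
                (∀ {b b′} → P b → P b′ → f b ≡ f b′ → b ≡ b′) →
                ∃[ bs ] (Unique bs × (∀ b → b ∈ₗ bs ⇔ P b) × length bs ≡ length cs)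
enumerate-via f {P} {cs} cs! lift image inj
  with bs , pbs , refl ← preimages f {P} {cs} (All.tabulate lift) =
    bs , Uniqueₚ.map⁻ cs! , (λ b → mk⇔ (All.lookup pbs) listed) , sym (length-map f bs)
  where
  listed : ∀ {b} → P b → b ∈ₗ bs
  listed pb with b′ , b′∈bs , eq ← ∈-map⁻ f (image pb)
    rewrite inj pb (All.lookup pbs b′∈bs) eq = b′∈bs

-- Prefixes, suffixes and factors of words.

module _ {A : Set} where

  prefix-++ : (u v : Word A) → IsPrefix u (u ++ v)
  prefix-++ u v = Prefix.fromView (Pointwise.refl refl Prefix.++ v)

  suffix-++ : (u v : Word A) → IsSuffix v (u ++ v)
  suffix-++ u v = Suffix.fromView (u Suffix.++ Pointwise.refl refl)

  prefix-split : {u w : Word A} → IsPrefix u w → ∃[ s ] w ≡ u ++ s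
  prefix-split p with eq Prefix.++ s ← Prefix.toView p rewrite Pointwise.Pointwise-≡⇒≡ eq = s , refl

  suffix-split : {u w : Word A} → IsSuffix u w → ∃[ p ] w ≡ p ++ u
  suffix-split p with q Suffix.++ eq ← Suffix.toView p rewrite Pointwise.Pointwise-≡⇒≡ eq = q , refl

  factor-++ : (p w s : Word A) → IsFactor w (p ++ w ++ s)
  factor-++ p w s = p ++ⁱ here (prefix-++ w s)

  factor-split : {u w : Word A} → IsFactor u w → ∃[ p ] ∃[ s ] w ≡ p ++ u ++ s
  factor-split i with Infix.MkView p eq s ← Infix.toView i rewrite Pointwise.Pointwise-≡⇒≡ eq = p , s , refl

  prefixes-comparable : {u v w : Word A} → IsPrefix u w → IsPrefix v w →
                        IsPrefix u v ⊎ IsPrefix v u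
  prefixes-comparable []         q          = inj₁ []
  prefixes-comparable (_ ∷ p)    []         = inj₂ []
  prefixes-comparable (refl ∷ p) (refl ∷ q) with prefixes-comparable p q
  ... | inj₁ h = inj₁ (refl ∷ h)
  ... | inj₂ h = inj₂ (refl ∷ h)

  suffixes-comparable : {u v w : Word A} → IsSuffix u w → IsSuffix v w →
                        IsSuffix u v ⊎ IsSuffix v u
  suffixes-comparable p q with prefixes-comparable (toPrefix-rev p) (toPrefix-rev q)
  ... | inj₁ h = inj₁ (fromPrefix-rev h)
  ... | inj₂ h = inj₂ (fromPrefix-rev h)

  inits-∷ʳ : (w : Word A) (a : A) → inits (w ∷ʳ a) ≡ inits w ∷ʳ (w ∷ʳ a)
  inits-∷ʳ []      a = refl
  inits-∷ʳ (b ∷ w) a = cong ([] ∷_) (trans (cong (map (b ∷_)) (inits-∷ʳ w a)) (map-++ (b ∷_) (inits w) _))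

  inits-unique : (w : Word A) → Unique (inits w)
  inits-unique []      = [] ∷ []
  inits-unique (a ∷ w) =
    Allₚ.¬Any⇒All¬ _ []∉map∷ ∷ Uniqueₚ.map⁺ ∷-injectiveʳ (inits-unique w)

  ∈-inits⁺ : {v w : Word A} → IsPrefix v w → v ∈ₗ inits w
  ∈-inits⁺ []         = here refl
  ∈-inits⁺ (refl ∷ p) = there (∈-map⁺ (_ ∷_) (∈-inits⁺ p))

  ∈-inits⁻ : {v w : Word A} → v ∈ₗ inits w → IsPrefix v w
  ∈-inits⁻             (here refl) = []
  ∈-inits⁻ {w = a ∷ w} (there v∈)  with _ , v∈′ , refl ← ∈-map⁻ (a ∷_) v∈ = refl ∷ ∈-inits⁻ v∈′

  -- Duplicate-free lists with the same members are permutations of each other, hence equally long.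
  parseCount-unique : {X : Language A} {w : Word A} {m n : ℕ} →
                      ParseCount X w m → ParseCount X w n → m ≡ n
  parseCount-unique (ps , ps! , ps⇔ , refl) (qs , qs! , qs⇔ , refl) =
    ↭-length (∼bag⇒↭ (unique∧set⇒bag ps! qs! λ {t} →
      mk⇔ (from (qs⇔ t) ∘ to (ps⇔ t)) (from (ps⇔ t) ∘ to (qs⇔ t))))
    where open Equivalence

  -- Reversal of words, codes and parses.

  mirror : Language A → Language A
  mirror X w = X (reverse w)

  mirror-bifix : {X : Language A} → IsBifixCode X → IsBifixCode (mirror X)
  mirror-bifix bifix = record
    { nonempty-words   = λ { x∈ refl → nonempty-words x∈ refl }
    ; no-proper-prefix = λ x∈ y∈ (p , x≢y) → no-proper-suffix x∈ y∈ (fromPrefix p , x≢y ∘ reverse-injective)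
    ; no-proper-suffix = λ x∈ y∈ (p , x≢y) → no-proper-prefix x∈ y∈ (toPrefix-rev p , x≢y ∘ reverse-injective)
    } where open IsBifixCode bifix

  mirror-triple : Word A × Word A × Word A → Word A × Word A × Word A
  mirror-triple (v , x , u) = reverse u , reverse x , reverse v

  mirror-triple-involutive : ∀ t → mirror-triple (mirror-triple t) ≡ t
  mirror-triple-involutive (v , x , u) =
    cong₂ _,_ (reverse-involutive v) (cong₂ _,_ (reverse-involutive x) (reverse-involutive u))

  module _ {X Y : Language A} (X⇒Y : ∀ {x} → x ∈ X → reverse x ∈ Y) where

    reverse-* : ∀ {xs} → All X xs → reverse (concat xs) ∈ (Y *)
    reverse-* []                          = [] , [] , refl
    reverse-* {x ∷ xs} (x∈X ∷ xs∈X) with ys , ys∈Y , eq ← reverse-* xs∈X =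
      ys ∷ʳ reverse x , Allₚ.∷ʳ⁺ ys∈Y (X⇒Y x∈X) ,
      trans (sym (concat-++ ys [ reverse x ]))
        (trans (cong₂ _++_ eq (++-identityʳ (reverse x))) (sym (reverse-++ x (concat xs))))

    reverse-∙A* : ∀ {w} → w ∈ (X ∙A*) → reverse w ∈ (A*∙ Y)
    reverse-∙A* (x , x∈X , p) = reverse x , X⇒Y x∈X , fromPrefix p

    reverse-A*∙ : ∀ {w} → w ∈ (A*∙ X) → reverse w ∈ (Y ∙A*)
    reverse-A*∙ (x , x∈X , p) = reverse x , X⇒Y x∈X , toPrefix-rev p

  module _ {X Y : Language A}
           (X⇒Y : ∀ {x} → x ∈ X → reverse x ∈ Y) (Y⇒X : ∀ {x} → x ∈ Y → reverse x ∈ X) where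

    -- The hypotheses are symmetric in `X` and `Y`, so one proof carries parses to the mirror code
    -- and back. The conditions on `v` and `u` trade places and, being negative, use the reversal
    -- from `Y` to `X`.
    mirror-parse : ∀ {w} t → IsParse X w t → IsParse Y (reverse w) (mirror-triple t)
    mirror-parse (v , x , u) (refl , v∉ , (xs , xs∈X , refl) , u∉) =
      trans (reverse-++ v _) (trans (cong (_++ reverse v) (reverse-++ x u)) (++-assoc (reverse u) _ _)) ,
      (λ h → u∉ (subst (_∈ (X ∙A*)) (reverse-involutive u) (reverse-A*∙ Y⇒X h))) ,
      reverse-* X⇒Y xs∈X ,
      (λ h → v∉ (subst (_∈ (A*∙ X)) (reverse-involutive v) (reverse-∙A* Y⇒X h)))

  mirror-parseCount : {X : Language A} {w : Word A} {n : ℕ} →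
                      ParseCount X w n → ParseCount (mirror X) (reverse w) n
  mirror-parseCount {X} {w} (ps , ps! , ps⇔ , refl) =
    map mirror-triple ps ,
    Uniqueₚ.map⁺ (λ {t} {t′} eq → trans (sym (mirror-triple-involutive t))
                    (trans (cong mirror-triple eq) (mirror-triple-involutive t′))) ps! ,
    (λ t → mk⇔ fwd (bwd t)) ,
    length-map mirror-triple ps
    where
    X⇒X̃ : ∀ {x} → x ∈ X → reverse x ∈ mirror X
    X⇒X̃ = subst X (sym (reverse-involutive _))
    fwd : ∀ {t} → t ∈ₗ map mirror-triple ps → IsParse (mirror X) (reverse w) t
    fwd t∈ with t′ , t′∈ , refl ← ∈-map⁻ mirror-triple t∈ =
      mirror-parse X⇒X̃ (λ x∈ → x∈) t′ (Equivalence.to (ps⇔ t′) t′∈)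
    bwd : ∀ t → IsParse (mirror X) (reverse w) t → t ∈ₗ map mirror-triple ps
    bwd t parse = subst (_∈ₗ _) (mirror-triple-involutive t)
      (∈-map⁺ mirror-triple (Equivalence.from (ps⇔ _)
        (subst (λ w′ → IsParse X w′ _) (reverse-involutive w)
          (mirror-parse (λ x∈ → x∈) X⇒X̃ t parse))))

-- Factorization over a bifix code, and parses with a given start.

module _ (em : ExcludedMiddle 0ℓ) {A : Set} where

  module _ {X : Language A} (bifix : IsBifixCode X) where
    open IsBifixCode bifix

    prefix⇒≡ : ∀ {x y} → x ∈ X → y ∈ X → IsPrefix x y → x ≡ y
    prefix⇒≡ {x} {y} x∈X y∈X p with em {x ≡ y}
    ... | yes eq = eq
    ... | no x≢y = contradiction (p , x≢y) (no-proper-prefix x∈X y∈X)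

    -- Code words are stripped from the left for as long as one is a prefix. They are nonempty, so
    -- the length decreases.
    factorize : ∀ w → Acc _<_ (length w) →
                ∃[ x ] ∃[ u ] (w ≡ x ++ u × x ∈ (X *) × u ∉ (X ∙A*))
    factorize w (acc rs) with em {w ∈ (X ∙A*)}
    ... | no  w∉ = [] , w , refl , ([] , [] , refl) , w∉
    ... | yes (y , y∈X , y≤w) with prefix-split y≤w
    ...   | q , refl with y
    ...     | []     = contradiction refl (nonempty-words y∈X)
    ...     | a ∷ y′ with factorize q (rs (s≤s (length-++-≤ʳ q {y′})))
    ...       | _ , u , refl , (xs , xs∈X , refl) , u∉ =
                  (a ∷ y′) ++ concat xs , u , sym (++-assoc (a ∷ y′) _ u) ,
                  (_ ∷ xs , y∈X ∷ xs∈X , refl) , u∉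

    -- Code words beginning the same word are prefix-comparable, hence equal, and cancel. If one
    -- list runs out first, the next word of the other list begins a remainder assumed to lie
    -- outside `X ∙A*`.
    factorize-unique : ∀ {xs ys u v} → All X xs → All X ys → u ∉ (X ∙A*) → v ∉ (X ∙A*) →
                       concat xs ++ u ≡ concat ys ++ v → concat xs ≡ concat ys × u ≡ v
    factorize-unique [] [] _ _ eq = refl , eq
    factorize-unique {ys = y ∷ ys} {v = v} [] (y∈X ∷ _) u∉ _ eq =
      contradiction (y , y∈X , subst (IsPrefix y) (sym (trans eq (++-assoc y _ v))) (prefix-++ y _)) u∉
    factorize-unique {xs = x ∷ xs} {u = u} (x∈X ∷ _) [] _ v∉ eq =
      contradiction (x , x∈X , subst (IsPrefix x) (trans (sym (++-assoc x _ u)) eq) (prefix-++ x _)) v∉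
    factorize-unique {x ∷ xs} {y ∷ ys} {u} {v} (x∈X ∷ xs∈X) (y∈X ∷ ys∈X) u∉ v∉ eq =
      go x≡y eq′
      where
      eq′ : x ++ concat xs ++ u ≡ y ++ concat ys ++ v
      eq′ = trans (sym (++-assoc x _ u)) (trans eq (++-assoc y _ v))
      x≡y : x ≡ y
      x≡y with prefixes-comparable (prefix-++ x _) (subst (IsPrefix y) (sym eq′) (prefix-++ y _))
      ... | inj₁ p = prefix⇒≡ x∈X y∈X p
      ... | inj₂ p = sym (prefix⇒≡ y∈X x∈X p)
      go : x ≡ y → x ++ concat xs ++ u ≡ y ++ concat ys ++ v →
           x ++ concat xs ≡ y ++ concat ys × u ≡ v
      go refl e with factorize-unique xs∈X ys∈X u∉ v∉ (++-cancelˡ x _ _ e)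
      ... | eqs , equ = cong (x ++_) eqs , equ

    parse-from-start : ∀ {v w} → IsPrefix v w → v ∉ (A*∙ X) →
                       ∃[ t ] (IsParse X w t × proj₁ t ≡ v)
    parse-from-start {v} p v∉ with q , refl ← prefix-split p
      with x , u , refl , x∈ , u∉ ← factorize q (<-wellFounded _) =
        (v , x , u) , (refl , v∉ , x∈ , u∉) , refl

    parse-unique : ∀ {w t t′} → IsParse X w t → IsParse X w t′ → proj₁ t ≡ proj₁ t′ → t ≡ t′
    parse-unique {t = v , _} (refl , _ , (xs , xs∈X , refl) , u∉)
                             (eq , _ , (ys , ys∈X , refl) , u′∉) refl
      with eqx , refl ← factorize-unique xs∈X ys∈X u∉ u′∉ (++-cancelˡ v _ _ eq)
      = cong (λ x → v , x , _) eqx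

  -- The parse-counting function and its growth.

  module _ (X : Language A) where

    start? : (v : Word A) → Dec (v ∉ (A*∙ X))
    start? v = em

    -- Only the possible first components of parses are counted; `δ-counts` identifies this with the
    -- number of parses. Excluded middle makes the count a total function on words.
    δ : Word A → ℕ
    δ w = length (filter start? (inits w))

    δ-∷ʳ : ∀ w a → δ (w ∷ʳ a) ≡ δ w + length (filter start? [ w ∷ʳ a ])
    δ-∷ʳ w a = trans (cong (length ∘ filter start?) (inits-∷ʳ w a))
      (trans (cong length (filter-++ start? (inits w) [ w ∷ʳ a ])) (length-++ (filter start? (inits w))))

    δ-∷ʳ-∈ : ∀ w a → (w ∷ʳ a) ∈ (A*∙ X) → δ (w ∷ʳ a) ≡ δ w
    δ-∷ʳ-∈ w a h = trans (δ-∷ʳ w a)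
      (trans (cong (λ l → δ w + length l) (filter-reject start? (λ k → k h))) (+-identityʳ _))

    δ-∷ʳ-∉ : ∀ w a → (w ∷ʳ a) ∉ (A*∙ X) → δ (w ∷ʳ a) ≡ suc (δ w)
    δ-∷ʳ-∉ w a h = trans (δ-∷ʳ w a)
      (trans (cong (λ l → δ w + length l) (filter-accept start? h)) (+-comm _ 1))

  -- The first component is a bijection from parses to possible starts: `parse-from-start` gives
  -- surjectivity, `parse-unique` injectivity.
  δ-counts : {X : Language A} → IsBifixCode X → ∀ w → ParseCount X w (δ X w)
  δ-counts {X} bifix w = enumerate-via proj₁ (Uniqueₚ.filter⁺ (start? X) (inits-unique w))
    (λ v∈ → let v∈inits , v∉ = ∈-filter⁻ (start? X) v∈
            in parse-from-start bifix (∈-inits⁻ v∈inits) v∉)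
    (λ { {v , x , u} (refl , v∉ , _) → ∈-filter⁺ (start? X) (∈-inits⁺ (prefix-++ v _)) v∉ })
    (parse-unique bifix)

  module _ {X : Language A} (bifix : IsBifixCode X) where

    -- By its definition, `δ` for the mirror code counts the possible last components `u`, reversed.
    -- Both sides count the same parses up to reversal, which gives access to the letters added on
    -- the left.
    δ-mirror : ∀ w → δ (mirror X) (reverse w) ≡ δ X w
    δ-mirror w = parseCount-unique (δ-counts (mirror-bifix bifix) (reverse w))
                                   (mirror-parseCount (δ-counts bifix w))

    δ-mirror-∷ : ∀ a w → δ X (a ∷ w) ≡ δ (mirror X) (reverse w ∷ʳ a)
    δ-mirror-∷ a w = trans (sym (δ-mirror (a ∷ w))) (cong (δ (mirror X)) (unfold-reverse a w))

    reverse-∷-∉ : ∀ a w → (a ∷ w) ∉ (X ∙A*) → (reverse w ∷ʳ a) ∉ (A*∙ mirror X)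
    reverse-∷-∉ a w h k = h (subst (_∈ (X ∙A*)) (reverse-involutive (a ∷ w))
      (reverse-A*∙ {X = mirror X} (λ x∈ → x∈) (subst (_∈ (A*∙ mirror X)) (sym (unfold-reverse a w)) k)))

    reverse-∷-∈ : ∀ a w → (a ∷ w) ∈ (X ∙A*) → (reverse w ∷ʳ a) ∈ (A*∙ mirror X)
    reverse-∷-∈ a w h = subst (_∈ (A*∙ mirror X)) (unfold-reverse a w)
      (reverse-∙A* {Y = mirror X} (λ x∈ → subst X (sym (reverse-involutive _)) x∈) h)

    -- This is the rule for a letter added on the right, read in `mirror X`.
    δ-∷-∈ : ∀ a w → (a ∷ w) ∈ (X ∙A*) → δ X (a ∷ w) ≡ δ X w
    δ-∷-∈ a w h = trans (δ-mirror-∷ a w)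
      (trans (δ-∷ʳ-∈ (mirror X) (reverse w) a (reverse-∷-∈ a w h)) (δ-mirror w))

    δ-∷-∉ : ∀ a w → (a ∷ w) ∉ (X ∙A*) → δ X (a ∷ w) ≡ suc (δ X w)
    δ-∷-∉ a w h = trans (δ-mirror-∷ a w)
      (trans (δ-∷ʳ-∉ (mirror X) (reverse w) a (reverse-∷-∉ a w h)) (cong suc (δ-mirror w)))

    δ-≤-++ʳ : ∀ w t → δ X w ≤ δ X (w ++ t)
    δ-≤-++ʳ w []      = ≤-reflexive (cong (δ X) (sym (++-identityʳ w)))
    δ-≤-++ʳ w (a ∷ t) = ≤-trans step
      (≤-trans (δ-≤-++ʳ (w ∷ʳ a) t) (≤-reflexive (cong (δ X) (++-assoc w [ a ] t))))
      where
      step : δ X w ≤ δ X (w ∷ʳ a)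
      step with em {(w ∷ʳ a) ∈ (A*∙ X)}
      ... | yes h = ≤-reflexive (sym (δ-∷ʳ-∈ X w a h))
      ... | no  h = ≤-trans (n≤1+n _) (≤-reflexive (sym (δ-∷ʳ-∉ X w a h)))

    δ-≤-++ˡ : ∀ t w → δ X w ≤ δ X (t ++ w)
    δ-≤-++ˡ []      w = ≤-refl
    δ-≤-++ˡ (a ∷ t) w = ≤-trans (δ-≤-++ˡ t w) step
      where
      step : δ X (t ++ w) ≤ δ X (a ∷ t ++ w)
      step with em {(a ∷ t ++ w) ∈ (X ∙A*)}
      ... | yes h = ≤-reflexive (sym (δ-∷-∈ a (t ++ w) h))
      ... | no  h = ≤-trans (n≤1+n _) (≤-reflexive (sym (δ-∷-∉ a (t ++ w) h)))

    -- If `p₂ ++ w` began with a code word for every nonempty suffix `p₂` of `p`, prepending the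
    -- letters of `p` one by one would never raise the count.
    δ-grows⇒∉ : ∀ p w → δ X w < δ X (p ++ w) →
                ∃[ p₁ ] ∃[ p₂ ] (p ≡ p₁ ++ p₂ × p₂ ≢ [] × (p₂ ++ w) ∉ (X ∙A*))
    δ-grows⇒∉ []      w lt = contradiction lt (<-irrefl refl)
    δ-grows⇒∉ (a ∷ p) w lt with em {(a ∷ p ++ w) ∈ (X ∙A*)}
    ... | no  h = [] , a ∷ p , refl , (λ ()) , h
    ... | yes h with p₁ , p₂ , refl , p₂≢[] , p₂w∉ ← δ-grows⇒∉ p w (subst (δ X w <_) (δ-∷-∈ a (p ++ w) h) lt) =
      a ∷ p₁ , p₂ , refl , p₂≢[] , p₂w∉

  -- Recurrent sets and words of maximal count.

  module _ {F X : Language A} (rec : IsRecurrent F) (X⊆F : X ⊆ F) (bifix : IsBifixCode X) where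
    open IsRecurrent rec
    open IsBifixCode bifix

    F-left : ∀ u {v} → (u ++ v) ∈ F → u ∈ F
    F-left u uv∈F = factorial (here (prefix-++ u _)) uv∈F

    F-right : ∀ u {v} → (u ++ v) ∈ F → v ∈ F
    F-right u uv∈F = factorial (fromSuffix (suffix-++ u _)) uv∈F

    -- Recurrence is used twice: `s` is inserted between `w` and `u`, then `p` between `u` and
    -- `w s u`.
    surround : ∀ {u w} → u ∈ F → w ∈ F → ∃[ p ] ∃[ s ] ((u ++ p) ++ w ++ (s ++ u)) ∈ F
    surround {u} {w} u∈F w∈F
      with s , _ , wsu∈F ← recurrent w∈F u∈F
      with p , _ , upwsu∈F ← recurrent u∈F wsu∈F =
        p , s , subst F (sym (++-assoc u p _)) upwsu∈F

    -- A word attaining the degree stands in for the number, so that it can be placed inside other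
    -- words of `F`.
    IsMaximum : Word A → Set
    IsMaximum z = z ∈ F × (∀ {w} → w ∈ F → δ X w ≤ δ X z)

    degree⇒maximum : ∀ {d} → IsDegree F X d → ∃[ z ] (IsMaximum z × δ X z ≡ d)
    degree⇒maximum ((z , z∈F , count) , bound) =
      let δz≡d = parseCount-unique (δ-counts bifix z) count in
      z , (z∈F , λ {w} w∈F → let n , count′ , n≤d = bound w w∈F in
        subst₂ _≤_ (parseCount-unique count′ (δ-counts bifix w)) (sym δz≡d) n≤d) , δz≡d

    maximum⇒degree : ∀ {z} → IsMaximum z → IsDegree F X (δ X z)
    maximum⇒degree {z} (z∈F , max) =
      (z , z∈F , δ-counts bifix z) , λ w w∈F → δ X w , δ-counts bifix w , max w∈F

    internal⇒∈F : InternalFactors X ⊆ F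
    internal⇒∈F {w} (p , s , _ , _ , pws∈X) = factorial (factor-++ p w s) (X⊆F pws∈X)

    -- For x = p w s ∈ X, dropping the last letter of s leaves a proper prefix of x, which
    -- has no prefix in X; hence its first letter contributes to δ.
    internal⇒δ< : ∀ {z w} → IsMaximum z → w ∈ InternalFactors X → δ X w < δ X z
    internal⇒δ< {w = w} _ ([] , _ , p≢[] , _) = contradiction refl p≢[]
    internal⇒δ< {z} {w} (_ , max) (a ∷ p , s , _ , s≢[] , x∈X) with initLast s
    ... | []       = contradiction refl s≢[]
    ... | s′ ∷ʳ′ b = begin-strict
      δ X w                  ≤⟨ δ-≤-++ʳ bifix w s′ ⟩
      δ X (w ++ s′)          ≤⟨ δ-≤-++ˡ bifix p (w ++ s′) ⟩
      δ X (p ++ w ++ s′)     <⟨ n<1+n _ ⟩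
      1 + δ X (p ++ w ++ s′) ≡⟨ δ-∷-∉ bifix a (p ++ w ++ s′) y∉ ⟨
      δ X y                  ≤⟨ max (F-left y (subst F x≡yb (X⊆F x∈X))) ⟩
      δ X z                  ∎
      where
      open ≤-Reasoning
      y = a ∷ p ++ w ++ s′
      x≡yb : a ∷ p ++ w ++ s′ ∷ʳ b ≡ y ∷ʳ b
      x≡yb = cong (a ∷_) (trans (cong (p ++_) (sym (++-assoc w s′ [ b ]))) (sym (++-assoc p _ [ b ])))
      y∉ : y ∉ (X ∙A*)
      y∉ (x′ , x′∈X , x′≤y) with q , y≡ ← prefix-split x′≤y =
        m≢1+m+n (length x′) (trans (cong length x′≡x) len)
        where
        x≡ : a ∷ p ++ w ++ s′ ∷ʳ b ≡ x′ ++ q ++ [ b ]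
        x≡ = trans x≡yb (trans (cong (_∷ʳ b) y≡) (++-assoc x′ q [ b ]))
        x′≡x : x′ ≡ x′ ++ q ++ [ b ]
        x′≡x = trans (prefix⇒≡ bifix x′∈X x∈X (subst (IsPrefix x′) (sym x≡) (prefix-++ x′ _))) x≡
        len : length (x′ ++ q ++ [ b ]) ≡ suc (length x′ + length q)
        len = trans (length-++ x′) (trans (cong (length x′ +_) (trans (length-++ q) (+-comm _ 1))) (+-suc _ _))

    -- Otherwise the first letter of `t` would raise the count of a word ending in `z`, already at
    -- least `δ X z`, beyond the maximum.
    maximum-extension : ∀ {z} → IsMaximum z → ∀ {t} → t ≢ [] → (t ++ z) ∈ F → (t ++ z) ∈ (X ∙A*)
    maximum-extension _ {[]} t≢[] _ = contradiction refl t≢[]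
    maximum-extension {z} (_ , max) {a ∷ t} _ tz∈F with em {(a ∷ t ++ z) ∈ (X ∙A*)}
    ... | yes h = h
    ... | no  h = contradiction (≤-trans (s≤s (δ-≤-++ˡ bifix t z))
                    (≤-trans (≤-reflexive (sym (δ-∷-∉ bifix a (t ++ z) h))) (max tz∈F))) 1+n≰n

    -- The left copy of `z` in `z p w s z` yields some `p₂ w` that begins with no code word; the
    -- right copy forces `p₂ w s z` to begin with one. That code word must run past `p₂ w`, so `w`
    -- lies strictly inside it.
    δ<⇒internal : ∀ {z w} → IsMaximum z → w ∈ F → δ X w < δ X z → w ∈ InternalFactors X
    δ<⇒internal {z} {w} z-max@(z∈F , _) w∈F δw<δz
      with p , s , g∈F ← surround z∈F w∈F
      -- The word `z p w` contains `z`, so its count exceeds that of `w`.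
      with p₁ , p₂ , zp≡ , p₂≢[] , p₂w∉ ← δ-grows⇒∉ bifix (z ++ p) w
             (<-≤-trans δw<δz (≤-trans (δ-≤-++ʳ bifix z p) (δ-≤-++ʳ bifix (z ++ p) w)))
      with x , x∈X , x≤h ← maximum-extension z-max {p₂ ++ w ++ s} (p₂≢[] ∘ ++-conicalˡ p₂ _)
             (subst F (trans (cong (p₂ ++_) (sym (++-assoc w s z))) (sym (++-assoc p₂ (w ++ s) z)))
               (F-right p₁ (subst F (trans (cong (_++ w ++ s ++ z) zp≡) (++-assoc p₁ p₂ _)) g∈F)))
      with prefixes-comparable x≤h
             (subst (IsPrefix (p₂ ++ w))
               (trans (++-assoc p₂ w _) (trans (cong (p₂ ++_) (sym (++-assoc w s z))) (sym (++-assoc p₂ (w ++ s) z))))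
               (prefix-++ (p₂ ++ w) (s ++ z)))
    ... | inj₁ x≤p₂w = contradiction (x , x∈X , x≤p₂w) p₂w∉
    ... | inj₂ p₂w≤x with t , x≡ ← prefix-split p₂w≤x =
      p₂ , t , p₂≢[] , t≢[] , subst X (trans x≡ (++-assoc p₂ w t)) x∈X
      where
      -- With `t` empty, `p₂ w` would itself be a code word.
      t≢[] : t ≢ []
      t≢[] refl = p₂w∉ (x , x∈X , subst (IsPrefix x) (trans x≡ (++-identityʳ _))
                                    (subst (IsPrefix x) (++-identityʳ x) (prefix-++ x [])))

    -- The nonempty borders `r` around `z` ensure that any code word containing the whole has `z` as
    -- an internal factor, whence `δ X z < δ X z`.
    maximum⇒thin : ∀ {z} → IsMaximum z → IsThin F X
    maximum⇒thin {z} z-max@(z∈F , _) with em {∃[ r ] (r ∈ F × r ≢ [])}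
    -- Here `F` has no nonempty word, so `X` is empty.
    ... | no  ¬r = z , z∈F , λ (x , x∈X , _) → ¬r (x , X⊆F x∈X , nonempty-words x∈X)
    ... | yes (r , r∈F , r≢[]) with p , s , g∈F ← surround r∈F z∈F =
      _ , g∈F , λ (x , x∈X , g≤x) → <-irrefl refl (internal⇒δ< z-max (internal x∈X g≤x))
      where
      internal : ∀ {x} → x ∈ X → IsFactor ((r ++ p) ++ z ++ s ++ r) x → z ∈ InternalFactors X
      internal x∈X g≤x with q , t , x≡ ← factor-split g≤x =
        q ++ r ++ p , (s ++ r) ++ t ,
        (λ eq → r≢[] (++-conicalˡ r p (++-conicalʳ q _ eq))) ,
        (λ eq → r≢[] (++-conicalʳ s r (++-conicalˡ (s ++ r) t eq))) ,
        subst X (trans x≡ (trans (cong (q ++_) (trans (++-assoc (r ++ p) _ t)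
          (cong ((r ++ p) ++_) (++-assoc z (s ++ r) t)))) (sym (++-assoc q (r ++ p) _)))) x∈X

    -- For `y ∈ Y`, the word `y v z` begins with some `x ∈ X`, which also lies in `Y`. Two members
    -- of the bifix code `Y` beginning the same word coincide.
    maximum⇒maximal : ∀ {z} → IsMaximum z → IsMaximalBifixCode F X
    maximum⇒maximal {z} z-max@(z∈F , _) = record
      { included = X⊆F
      ; bifix    = bifix
      ; maximal  = λ Y Y-bifix Y⊆F (X⊆Y , Y⊈X) → Y⊈X (Y⊆X Y Y-bifix Y⊆F X⊆Y)
      }
      where
      Y⊆X : ∀ (Y : Language A) → IsBifixCode Y → Y ⊆ F → X ⊆ Y → Y ⊆ X
      Y⊆X Y Y-bifix Y⊆F X⊆Y {y} y∈Y
        with v , _ , yvz∈F ← recurrent (Y⊆F y∈Y) z∈F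
        with x , x∈X , x≤ ← maximum-extension z-max {y ++ v}
               (IsBifixCode.nonempty-words Y-bifix y∈Y ∘ ++-conicalˡ y v)
               (subst F (sym (++-assoc y v z)) yvz∈F)
        with prefixes-comparable x≤ (subst (IsPrefix y) (sym (++-assoc y v z)) (prefix-++ y _))
      ... | inj₁ x≤y = subst X (prefix⇒≡ Y-bifix (X⊆Y x∈X) y∈Y x≤y) x∈X
      ... | inj₂ y≤x = subst X (sym (prefix⇒≡ Y-bifix y∈Y (X⊆Y x∈X) y≤x)) x∈X

    -- From thinness and maximality to a maximum.

    PrefixComparable SuffixComparable : Word A → Set
    PrefixComparable y = ∃[ x ] (x ∈ X × (IsPrefix x y ⊎ IsPrefix y x))
    SuffixComparable y = ∃[ x ] (x ∈ X × (IsSuffix x y ⊎ IsSuffix y x))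

    -- Adjoining `y` to `X` keeps it a bifix code inside `F`. The inclusion is strict because a
    -- member of `X` would be comparable with itself.
    incomparable⇒extensible : ∀ {y} → y ∈ F → y ≢ [] → ¬ PrefixComparable y → ¬ SuffixComparable y →
                              ¬ IsMaximalBifixCode F X
    incomparable⇒extensible {y} y∈F y≢[] ¬pre ¬suf X-max =
      IsMaximalBifixCode.maximal X-max Y Y-bifix Y⊆F
        (inj₁ , λ Y⊆X → ¬pre (y , Y⊆X (inj₂ refl) , inj₁ (subst (IsPrefix y) (++-identityʳ y) (prefix-++ y []))))
      where
      Y : Language A
      Y w = w ∈ X ⊎ w ≡ y
      Y⊆F : Y ⊆ F
      Y⊆F (inj₁ x∈X)  = X⊆F x∈X
      Y⊆F (inj₂ refl) = y∈F
      Y-bifix : IsBifixCode Y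
      Y-bifix = record
        { nonempty-words   = λ { (inj₁ x∈X) → nonempty-words x∈X ; (inj₂ refl) → y≢[] }
        ; no-proper-prefix = λ
          { (inj₁ u∈X)  (inj₁ v∈X)  → no-proper-prefix u∈X v∈X
          ; (inj₁ u∈X)  (inj₂ refl) (p , _) → ¬pre (_ , u∈X , inj₁ p)
          ; (inj₂ refl) (inj₁ v∈X)  (p , _) → ¬pre (_ , v∈X , inj₂ p)
          ; (inj₂ refl) (inj₂ refl) (_ , y≢y) → y≢y refl }
        ; no-proper-suffix = λ
          { (inj₁ u∈X)  (inj₁ v∈X)  → no-proper-suffix u∈X v∈X
          ; (inj₁ u∈X)  (inj₂ refl) (p , _) → ¬suf (_ , u∈X , inj₁ p)
          ; (inj₂ refl) (inj₁ v∈X)  (p , _) → ¬suf (_ , v∈X , inj₂ p)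
          ; (inj₂ refl) (inj₂ refl) (_ , y≢y) → y≢y refl }
        }

    -- If y is prefix-incomparable with X and y′ suffix-incomparable with X, some y v y′ ∈ F is both.
    maximal⇒comparable : IsMaximalBifixCode F X →
      (∀ {y} → y ∈ F → y ≢ [] → PrefixComparable y) ⊎ (∀ {y} → y ∈ F → y ≢ [] → SuffixComparable y)
    maximal⇒comparable X-max with em {∃[ y ] (y ∈ F × y ≢ [] × ¬ PrefixComparable y)}
    ... | no  none = inj₁ λ {y} y∈F y≢[] → decidable-stable em λ ¬pre → none (y , y∈F , y≢[] , ¬pre)
    ... | yes (y , y∈F , y≢[] , ¬pre) = inj₂ λ {y′} y′∈F y′≢[] → decidable-stable em λ ¬suf →
      let v , _ , yvy′∈F = recurrent y∈F y′∈F in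
      incomparable⇒extensible yvy′∈F (y≢[] ∘ ++-conicalˡ y _) (¬pre ∘ restrict-pre) (¬suf ∘ restrict-suf y v) X-max
      where
      -- Comparability descends to prefixes here and to suffixes below, so incomparability ascends
      -- to `y v y′` from both ends.
      restrict-pre : ∀ {t} → PrefixComparable (y ++ t) → PrefixComparable y
      restrict-pre (x , x∈X , inj₁ p) = x , x∈X , prefixes-comparable p (prefix-++ y _)
      restrict-pre (x , x∈X , inj₂ p) with s , refl ← prefix-split p =
        _ , x∈X , inj₂ (subst (IsPrefix y) (sym (++-assoc y _ s)) (prefix-++ y _))
      restrict-suf : ∀ u v {y′} → SuffixComparable (u ++ v ++ y′) → SuffixComparable y′
      restrict-suf u v {y′} h with subst SuffixComparable (sym (++-assoc u v y′)) h
      ... | x , x∈X , inj₁ p = x , x∈X , suffixes-comparable p (suffix-++ (u ++ v) y′)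
      ... | x , x∈X , inj₂ p with s , refl ← suffix-split p =
        _ , x∈X , inj₂ (subst (IsSuffix y′) (++-assoc s (u ++ v) y′) (suffix-++ (s ++ u ++ v) y′))

    NonFactor : Word A → Set
    NonFactor w = ¬ (∃[ x ] (x ∈ X × IsFactor w x))

    -- An extension `a t w` in `F` cannot be a prefix of a code word, since `w` would be a factor of
    -- it. Comparability then makes it begin with a code word, so the letter `a` adds no parse.
    δ-constant-++ˡ : (∀ {y} → y ∈ F → y ≢ [] → PrefixComparable y) →
                     ∀ {w} → NonFactor w → ∀ t → (t ++ w) ∈ F → δ X (t ++ w) ≡ δ X w
    δ-constant-++ˡ comp         nf []      _     = refl
    δ-constant-++ˡ comp {w = w} nf (a ∷ t) atw∈F with comp atw∈F (λ ())
    ... | x , x∈X , inj₁ p = trans (δ-∷-∈ bifix a (t ++ w) (x , x∈X , p))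
                                   (δ-constant-++ˡ comp nf t (F-right [ a ] atw∈F))
    ... | x , x∈X , inj₂ p with s , refl ← prefix-split p =
      contradiction (_ , x∈X , (fromSuffix (suffix-++ (a ∷ t) w) ⁱ++ s)) nf

    -- Dual to the previous argument, except that the recursion absorbs the letter next to `w`. The
    -- base word grows to `w ∷ʳ a`, which is again not a factor of `X`.
    δ-constant-++ʳ : (∀ {y} → y ∈ F → y ≢ [] → SuffixComparable y) →
                     ∀ {w} → NonFactor w → ∀ t → (w ++ t) ∈ F → δ X (w ++ t) ≡ δ X w
    δ-constant-++ʳ comp {w} nf []      _     = cong (δ X) (++-identityʳ w)
    δ-constant-++ʳ comp {w} nf (a ∷ t) wat∈F =
      trans (cong (δ X) (sym (++-assoc w [ a ] t)))
        (trans (δ-constant-++ʳ comp nf′ t wat∈F′) step)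
      where
      wat∈F′ : ((w ∷ʳ a) ++ t) ∈ F
      wat∈F′ = subst F (sym (++-assoc w [ a ] t)) wat∈F
      nf′ : NonFactor (w ∷ʳ a)
      nf′ (x , x∈X , i) with p , s , refl ← factor-split i =
        nf (_ , x∈X , p ++ⁱ (here (prefix-++ w [ a ]) ⁱ++ s))
      step : δ X (w ∷ʳ a) ≡ δ X w
      step with comp (F-left (w ∷ʳ a) wat∈F′) (λ eq → contradiction (++-conicalʳ w [ a ] eq) (λ ()))
      ... | x , x∈X , inj₁ p = δ-∷ʳ-∈ X w a (x , x∈X , p)
      ... | x , x∈X , inj₂ p = contradiction (x , x∈X , fromSuffix p) nf′

    -- The word witnessing thinness attains the maximum: recurrence joins it to any `w` of `F`, and
    -- the joined word has count `δ X z` by constancy and at least `δ X w` by monotonicity.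
    thin∧maximal⇒maximum : IsThin F X → IsMaximalBifixCode F X → ∃[ z ] IsMaximum z
    thin∧maximal⇒maximum (z , z∈F , nf) X-max = z , z∈F , bound (maximal⇒comparable X-max)
      where
      bound : _ → ∀ {w} → w ∈ F → δ X w ≤ δ X z
      bound (inj₁ comp) {w} w∈F with v , _ , wvz∈F ← recurrent w∈F z∈F =
        ≤-trans (δ-≤-++ʳ bifix w (v ++ z)) (≤-reflexive
          (trans (cong (δ X) (sym (++-assoc w v z)))
            (δ-constant-++ˡ comp nf (w ++ v) (subst F (sym (++-assoc w v z)) wvz∈F))))
      bound (inj₂ comp) {w} w∈F with v , _ , zvw∈F ← recurrent z∈F w∈F =
        ≤-trans (δ-≤-++ˡ bifix (z ++ v) w) (≤-reflexive
          (trans (cong (δ X) (++-assoc z v w)) (δ-constant-++ʳ comp nf (v ++ w) zvw∈F)))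

mainTheorem2 : ExcludedMiddle 0ℓ →
    {A : Set} {k : ℕ} → A ↔ Fin k →
    (F X : Language A) → IsRecurrent F → X ⊆ F → IsBifixCode X →
    ((IsThin F X × IsMaximalBifixCode F X) ⇔ HasFiniteDegree F X)
    × (∀ d → IsDegree F X d → InternalFactors X ≐ ParseCountBelow F X d)
mainTheorem2 em _ F X rec X⊆F bifix =
  mk⇔ (λ (thin , maximal) →
        let z , z-max = thin∧maximal⇒maximum em rec X⊆F bifix thin maximal
        in δ em X z , maximum⇒degree em rec X⊆F bifix z-max)
      (λ (d , deg) →
        let z , z-max , _ = degree⇒maximum em rec X⊆F bifix deg
        in maximum⇒thin em rec X⊆F bifix z-max , maximum⇒maximal em rec X⊆F bifix z-max) ,
  λ d deg → let z , z-max , δz≡d = degree⇒maximum em rec X⊆F bifix deg in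
    (λ {w} w∈I → internal⇒∈F em rec X⊆F bifix w∈I ,
       δ em X w , δ-counts em bifix w ,
       subst (δ em X w <_) δz≡d (internal⇒δ< em rec X⊆F bifix z-max w∈I)) ,
    -- The given count `n` comes with its own list of parses; uniqueness of the count identifies it
    -- with `δ em X w`.
    λ {w} (w∈F , n , count , n<d) → δ<⇒internal em rec X⊆F bifix z-max w∈F
       (subst₂ _<_ (parseCount-unique count (δ-counts em bifix w)) (sym δz≡d) n<d)
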